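{- If a propositional logic $\mathbf{L}$ has an effective sequential approximation, then $\mathrm{Frm}\setminus\mathbf{L}$ is effectively (recursively) enumerable.
   Context: A propositional language has variables $X_1,X_2,\dots$ and finitely many connectives with fixed arities; $\mathrm{Frm}$ is its set of formulas. A propositional logic is a subset $\mathbf{L}\subseteq\mathrm{Frm}$ closed under substitution. A finite-valued logic $\mathbf{M}$ consists of a finite set $V(\mathbf{M})$ of truth values, a subset $V^+(\mathbf{M})$ of designated values, and a truth function $V(\mathbf{M})^n\to V(\mathbf{M})$ for each $n$-ary connective; valuations map variables to truth values and extend to formulas; $\mathrm{Taut}(\mathbf{M})$ is the set of formulas designated under every valuation. Write $\mathbf{M}\unlhd\mathbf{M}'$ if $\mathrm{Taut}(\mathbf{M})\subseteq\mathrm{Taut}(\mathbf{M}')$. A sequential approximation of $\mathbf{L}$ is a sequence $\langle\mathbf{M}_1,\mathbf{M}_2,\dots\rangle$ of finite-valued logics such that $\mathbf{M}_i\unlhd\mathbf{M}_j$ whenever $i\ge j$, and $\mathbf{L}=\bigcap_j\mathrm{Taut}(\mathbf{M}_j)$. It is effective if there is an algorithm that on input $i$ outputs (a finite description of) $\mathbf{M}_i$. -}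

module Defs where

open import Data.Nat using (ℕ; _≤_)
open import Data.Fin using (Fin)
open import Data.Vec using (Vec; []; _∷_)
open import Data.Bool using (Bool; true; false)
open import Data.Maybe using (Maybe; just)
open import Data.Product using (Σ; ∃; _×_)
open import Relation.Binary.PropositionalEquality using (_≡_)
open import Relation.Nullary using (¬_)
open import Function.Bundles using (_⇔_)

data Frm {k : ℕ} (ar : Fin k → ℕ) : Set where
  var : ℕ → Frm ar
  app : (c : Fin k) → Vec (Frm ar) (ar c) → Frm ar

module _ {k : ℕ} {ar : Fin k → ℕ} where

  mutual
    subst : (ℕ → Frm ar) → Frm ar → Frm ar
    subst σ (var x)    = σ x
    subst σ (app c as) = app c (substVec σ as)

    substVec : ∀ {m} → (ℕ → Frm ar) → Vec (Frm ar) m → Vec (Frm ar) m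
    substVec σ []       = []
    substVec σ (a ∷ as) = subst σ a ∷ substVec σ as

IsPropLogic : ∀ {k} {ar : Fin k → ℕ} → (Frm ar → Set) → Set
IsPropLogic {ar = ar} L = ∀ (σ : ℕ → Frm ar) (φ : Frm ar) → L φ → L (subst σ φ)

record FVLogic {k : ℕ} (ar : Fin k → ℕ) : Set where
  field
    size       : ℕ
    designated : Fin size → Bool
    op         : (c : Fin k) → Vec (Fin size) (ar c) → Fin size

module _ {k : ℕ} {ar : Fin k → ℕ} (M : FVLogic ar) where
  open FVLogic M

  Valuation : Set
  Valuation = ℕ → Fin size

  mutual
    eval : Valuation → Frm ar → Fin size
    eval v (var x)    = v x
    eval v (app c as) = op c (evalVec v as)

    evalVec : ∀ {m} → Valuation → Vec (Frm ar) m → Vec (Fin size) m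
    evalVec v []       = []
    evalVec v (a ∷ as) = eval v a ∷ evalVec v as

  Taut : Frm ar → Set
  Taut φ = ∀ (v : Valuation) → designated (eval v φ) ≡ true

_⊴_ : ∀ {k} {ar : Fin k → ℕ} → FVLogic ar → FVLogic ar → Set
_⊴_ {ar = ar} M M' = ∀ (φ : Frm ar) → Taut M φ → Taut M' φ

-- A sequential approximation of L (indexed from 0 instead of 1).
-- "Effective" is rendered synthetically: the sequence is an Agda function ℕ → FVLogic ar,
-- each FVLogic being a finite description (finite tables).
IsSeqApprox : ∀ {k} {ar : Fin k → ℕ} → (Frm ar → Set) → (ℕ → FVLogic ar) → Set
IsSeqApprox {ar = ar} L M =
  (∀ (i j : ℕ) → j ≤ i → M i ⊴ M j) ×
  (∀ (φ : Frm ar) → L φ ⇔ (∀ (j : ℕ) → Taut (M j) φ))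

-- A set of formulas is (synthetically) effectively enumerable if it is the range of
-- an Agda function ℕ → Maybe (Frm ar) (Maybe allows the empty set).
Enumerable : ∀ {k} {ar : Fin k → ℕ} → (Frm ar → Set) → Set
Enumerable {ar = ar} P =
  Σ (ℕ → Maybe (Frm ar)) λ f → ∀ (φ : Frm ar) → P φ ⇔ (∃ λ n → f n ≡ just φ)

-- Markov's principle (classically valid; needed to read "φ ∉ L" constructively).
MarkovPrinciple : Set
MarkovPrinciple = ∀ (p : ℕ → Bool) → ¬ (∀ n → p n ≡ false) → ∃ λ n → p n ≡ true

module Submission where

-- Tautologyhood in a finite matrix is decidable: only the finitely many variables of φ matter,
-- and they range over finitely many truth values. So "M j refutes φ" is a decidable relation,
-- and Markov's principle turns φ ∉ L, i.e. ¬ (∀ j → Taut (M j) φ), into ∃ j refuting φ.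
-- Dovetailing this search over j with an enumeration of all formulas enumerates Frm ∖ L.

open import Defs
open import Data.Nat using (ℕ; zero; suc; _+_; _⊔_; _^_; _≤_; _<_; _≤′_; ≤′-refl; ≤′-step; s≤s)
open import Data.Nat.Properties using (+-suc; +-identityʳ; suc-injective; m≤m⊔n; m≤n⊔m; ≤⇒≤′; <⇒≤; <-≤-trans; n<1+n; m⊓n≤n; m≤n⇒m⊓n≡m)
open import Data.Fin using (Fin; toℕ; fromℕ<; finToFun; funToFin)
open import Data.Fin.Properties using (toℕ-fromℕ<; finToFun-funToFin; all?)
open import Data.Vec using (Vec; []; _∷_)
open import Data.Vec.Relation.Unary.All using (All; []; _∷_)
import Data.Vec.Relation.Unary.All as All
open import Data.List using (List; []; _∷_; [_]; _++_; map; concatMap; cartesianProductWith; allFin; filter; head; drop)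
open import Data.List.Relation.Unary.Any using (here; there)
open import Data.List.Membership.Propositional using (_∈_; lose)
open import Data.List.Membership.Propositional.Properties using (∈-map⁺; ∈-++⁺ˡ; ∈-++⁺ʳ; ∈-concatMap⁺; ∈-allFin; ∈-cartesianProductWith⁺; ∈-filter⁺; ∈-filter⁻)
open import Data.Bool using (true; false)
import Data.Bool.Properties as Bool
open import Data.Maybe using (Maybe; just)
open import Data.Product using (Σ; ∃; _×_; _,_; proj₁; proj₂)
import Data.Product as Product
open import Function using (_∘_; id)
open import Function.Bundles using (_⇔_; mk⇔; Equivalence)
open import Function.Properties.Equivalence using () renaming (trans to ⇔-trans; sym to ⇔-sym)
open import Relation.Nullary using (¬_; yes; no; ¬?)
open import Relation.Nullary.Decidable using (isNo)
import Relation.Nullary.Decidable as Dec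
open import Relation.Unary using (Decidable)
open import Relation.Binary.PropositionalEquality using (_≡_; refl; cong; cong₂; sym; trans; module ≡-Reasoning)

-- Cantor's enumeration of ℕ × ℕ, walking each diagonal a + b = d from (0 , d) to (d , 0).
next : ℕ × ℕ → ℕ × ℕ
next (a , zero)  = 0 , suc a
next (a , suc b) = suc a , b

unpair : ℕ → ℕ × ℕ
unpair zero    = 0 , 0
unpair (suc m) = next (unpair m)

unpair-surjective : ∀ a b → ∃ λ m → unpair m ≡ (a , b)
unpair-surjective a b = onDiagonal (a + b) a b refl
  where
  onDiagonal : ∀ d a b → a + b ≡ d → ∃ λ m → unpair m ≡ (a , b)
  onDiagonal _       zero    zero    _  = 0 , refl
  onDiagonal zero    zero    (suc b) ()
  onDiagonal (suc d) zero    (suc b) eq = Product.map suc (cong next) (onDiagonal d b 0 (trans (+-identityʳ b) (suc-injective eq)))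
  onDiagonal d       (suc a) b       eq = Product.map suc (cong next) (onDiagonal d a (suc b) (trans (+-suc a b) eq))

module _ {A : Set} where

  ∈⇒head-drop : ∀ {x : A} {xs} → x ∈ xs → ∃ λ i → head (drop i xs) ≡ just x
  ∈⇒head-drop (here refl) = 0 , refl
  ∈⇒head-drop (there x∈)  = Product.map suc id (∈⇒head-drop x∈)

  head-drop⇒∈ : ∀ {x : A} xs i → head (drop i xs) ≡ just x → x ∈ xs
  head-drop⇒∈ []       zero    ()
  head-drop⇒∈ []       (suc i) ()
  head-drop⇒∈ (y ∷ xs) zero    refl = here refl
  head-drop⇒∈ (y ∷ xs) (suc i) eq   = there (head-drop⇒∈ xs i eq)

  enumerate-⋃ : (g : ℕ → List A) →
                Σ (ℕ → Maybe A) λ f → ∀ x → (∃ λ n → x ∈ g n) ⇔ (∃ λ m → f m ≡ just x)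
  enumerate-⋃ g = f , λ x → mk⇔ to from
    where
    f : ℕ → Maybe A
    f m = head (drop (proj₂ (unpair m)) (g (proj₁ (unpair m))))

    to : ∀ {x} → ∃ (λ n → x ∈ g n) → ∃ λ m → f m ≡ just x
    to (n , x∈) with i , eq ← ∈⇒head-drop x∈ with m , refl ← unpair-surjective n i = m , eq

    from : ∀ {x} → ∃ (λ m → f m ≡ just x) → ∃ λ n → x ∈ g n
    from (m , eq) = proj₁ (unpair m) , head-drop⇒∈ (g (proj₁ (unpair m))) (proj₂ (unpair m)) eq

  enumerate-∃ : (e : ℕ → List A) → (∀ x → ∃ λ a → x ∈ e a) →
                {Q : ℕ → A → Set} → (∀ n → Decidable (Q n)) →
                Σ (ℕ → Maybe A) λ f → ∀ x → (∃ λ n → Q n x) ⇔ (∃ λ m → f m ≡ just x)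
  enumerate-∃ e e-complete {Q} Q? = Product.map id (λ ⋃-correct x → ⇔-trans (mk⇔ to from) (⋃-correct x)) (enumerate-⋃ stage)
    where
    stage : ℕ → List A
    stage m = filter (Q? (proj₂ (unpair m))) (e (proj₁ (unpair m)))

    to : ∀ {x} → ∃ (λ n → Q n x) → ∃ λ m → x ∈ stage m
    to {x} (n , q) with a , x∈ ← e-complete x with m , refl ← unpair-surjective a n = m , ∈-filter⁺ (Q? n) x∈ q

    from : ∀ {x} → ∃ (λ m → x ∈ stage m) → ∃ λ n → Q n x
    from (m , x∈) = let a , n = unpair m in n , proj₂ (∈-filter⁻ (Q? n) {xs = e a} x∈)

  vectors : ∀ m → List A → List (Vec A m)
  vectors zero    xs = [ [] ]
  vectors (suc m) xs = cartesianProductWith _∷_ xs (vectors m xs)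

  ∈-vectors : ∀ {m xs} {v : Vec A m} → All (_∈ xs) v → v ∈ vectors m xs
  ∈-vectors []         = here refl
  ∈-vectors (x∈ ∷ v∈) = ∈-cartesianProductWith⁺ _∷_ x∈ (∈-vectors v∈)

markov-¬∀ : MarkovPrinciple → {P : ℕ → Set} → Decidable P → ¬ (∀ n → P n) → ∃ λ n → ¬ P n
markov-¬∀ markov {P} P? ¬∀P = Product.map id isNo⇒¬ (markov (isNo ∘ P?) (λ never → ¬∀P (¬isNo⇒ never)))
  where
  isNo⇒¬ : ∀ {n} → isNo (P? n) ≡ true → ¬ P n
  isNo⇒¬ {n} eq with P? n | eq
  ... | no ¬p | _ = ¬p

  ¬isNo⇒ : (∀ n → isNo (P? n) ≡ false) → ∀ n → P n
  ¬isNo⇒ never n with P? n | never n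
  ... | yes p | _ = p

clamp : ∀ n → ℕ → Fin (suc n)
clamp n x = fromℕ< (s≤s (m⊓n≤n x n))

toℕ-clamp : ∀ {n x} → x ≤ n → toℕ (clamp n x) ≡ x
toℕ-clamp x≤n = trans (toℕ-fromℕ< _) (m≤n⇒m⊓n≡m x≤n)

module _ {k : ℕ} {ar : Fin k → ℕ} where

  formulas : ℕ → List (Frm ar)
  formulas zero    = []
  formulas (suc n) = formulas n ++ var n ∷ concatMap (λ c → map (app c) (vectors (ar c) (formulas n))) (allFin k)

  formulas-mono : ∀ {m n φ} → m ≤ n → φ ∈ formulas m → φ ∈ formulas n
  formulas-mono = go ∘ ≤⇒≤′
    where
    go : ∀ {m n φ} → m ≤′ n → φ ∈ formulas m → φ ∈ formulas n
    go ≤′-refl       φ∈ = φ∈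
    go (≤′-step m≤n) φ∈ = ∈-++⁺ˡ (go m≤n φ∈)

  mutual
    formulas-complete : ∀ φ → ∃ λ n → φ ∈ formulas n
    formulas-complete (var x)    = suc x , ∈-++⁺ʳ (formulas x) (here refl)
    formulas-complete (app c as) with n , as∈ ← formulasVec-complete as =
      suc n , ∈-++⁺ʳ (formulas n) (there (∈-concatMap⁺ _ (lose (∈-allFin c) (∈-map⁺ (app c) (∈-vectors as∈)))))

    formulasVec-complete : ∀ {m} (as : Vec (Frm ar) m) → ∃ λ n → All (_∈ formulas n) as
    formulasVec-complete []       = 0 , []
    formulasVec-complete (a ∷ as) with n₁ , a∈ ← formulas-complete a | n₂ , as∈ ← formulasVec-complete as =
      n₁ ⊔ n₂ , formulas-mono (m≤m⊔n n₁ n₂) a∈ ∷ All.map (formulas-mono (m≤n⊔m n₁ n₂)) as∈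

  mutual
    varBound : Frm ar → ℕ
    varBound (var x)    = suc x
    varBound (app c as) = varBoundVec as

    varBoundVec : ∀ {m} → Vec (Frm ar) m → ℕ
    varBoundVec []       = 0
    varBoundVec (a ∷ as) = varBound a ⊔ varBoundVec as

  module _ (M : FVLogic ar) where
    open FVLogic M

    mutual
      eval-agree : ∀ (v w : Valuation M) φ → (∀ x → x < varBound φ → v x ≡ w x) → eval M v φ ≡ eval M w φ
      eval-agree v w (var x)    v≗w = v≗w x (n<1+n x)
      eval-agree v w (app c as) v≗w = cong (op c) (evalVec-agree v w as v≗w)

      evalVec-agree : ∀ {m} (v w : Valuation M) (as : Vec (Frm ar) m) →
                      (∀ x → x < varBoundVec as → v x ≡ w x) → evalVec M v as ≡ evalVec M w as
      evalVec-agree v w []       v≗w = refl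
      evalVec-agree v w (a ∷ as) v≗w =
        cong₂ _∷_ (eval-agree v w a (λ x x< → v≗w x (<-≤-trans x< (m≤m⊔n _ _))))
                  (evalVec-agree v w as (λ x x< → v≗w x (<-≤-trans x< (m≤n⊔m (varBound a) _))))

    -- Only the variables below n = varBound φ matter, so the valuations may be restricted to the finitely
    -- many maps Fin (suc n) → Fin size, coded by Fin (size ^ suc n); suc n keeps clamp total when n = 0.
    finiteValuation : ∀ n → Fin (size ^ suc n) → Valuation M
    finiteValuation n i = finToFun {size} {suc n} i ∘ clamp n

    Taut⇔finiteTaut : ∀ φ → let n = varBound φ in
                      Taut M φ ⇔ (∀ i → designated (eval M (finiteValuation n i) φ) ≡ true)
    Taut⇔finiteTaut φ = mk⇔ (λ taut i → taut _) finiteTaut⇒Taut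
      where
      open ≡-Reasoning
      n = varBound φ

      finiteTaut⇒Taut : (∀ i → designated (eval M (finiteValuation n i) φ) ≡ true) → Taut M φ
      finiteTaut⇒Taut finiteTaut v = begin
        designated (eval M v φ)                     ≡⟨ cong designated (eval-agree v _ φ v≗) ⟩
        designated (eval M (finiteValuation n i) φ) ≡⟨ finiteTaut i ⟩
        true                                        ∎
        where
        w : Fin (suc n) → Fin size
        w = v ∘ toℕ

        i : Fin (size ^ suc n)
        i = funToFin w

        v≗ : ∀ x → x < n → v x ≡ finiteValuation n i x
        v≗ x x<n = sym (trans (finToFun-funToFin w (clamp n x)) (cong v (toℕ-clamp (<⇒≤ x<n))))

    taut? : Decidable (Taut M)
    taut? φ = Dec.map (⇔-sym (Taut⇔finiteTaut φ)) (all? (λ i → designated _ Bool.≟ true))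

proposition8 : MarkovPrinciple → ∀ {k : ℕ} (ar : Fin k → ℕ) (L : Frm ar → Set) → IsPropLogic L → (M : ℕ → FVLogic ar) → IsSeqApprox L M → Enumerable (λ φ → ¬ L φ)
proposition8 markov ar L _ M (_ , L⇔⋂Taut) =
  Product.map id (λ correct φ → ⇔-trans (¬L⇔refuted φ) (correct φ))
    (enumerate-∃ formulas formulas-complete (λ j φ → ¬? (taut? (M j) φ)))
  where
  ¬L⇔refuted : ∀ φ → (¬ L φ) ⇔ (∃ λ j → ¬ Taut (M j) φ)
  ¬L⇔refuted φ = mk⇔
    (λ ¬Lφ → markov-¬∀ markov (λ j → taut? (M j) φ) (¬Lφ ∘ Equivalence.from (L⇔⋂Taut φ)))
    (λ { (j , ¬taut) Lφ → ¬taut (Equivalence.to (L⇔⋂Taut φ) Lφ j) })
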